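{- For every infinite cardinal $\kappa$ and each positive integer $k$, $\mathrm{SDHL}(1,k,\kappa)$ holds.
   Context: A tree $T\subseteq {}^{<\kappa}\kappa$ is a set of sequences closed under initial segments, ordered by end-extension $\sqsubseteq$; $T(\zeta):=T\cap{}^{\zeta}\kappa$ is its $\zeta$-th level. $T$ is a $\kappa$-tree if $|T|=\kappa$ and every level of $T$ has cardinality less than $\kappa$. $T$ is perfect if every node of $T$ has an extension in $T$ which splits in $T$. $T\subseteq{}^{<\kappa}\kappa$ is regular if it is a perfect $\kappa$-tree in which every maximal branch has cofinality $\kappa$. $\mathrm{Cone}(t):=\{s\in{}^{<\kappa}\kappa:s\sqsupseteq t\}$. $X\subseteq{}^{<\kappa}\kappa$ dominates $Y\subseteq{}^{<\kappa}\kappa$ if $(\forall y\in Y)(\exists x\in X)\ y\sqsubseteq x$. Level-product: for an ordinal $\delta>0$ and $X_i\subseteq{}^{<\kappa}\kappa$ ($i<\delta$), with $X_i(\zeta):=X_i\cap{}^{\zeta}\kappa$, $\bigotimes_{i<\delta}X_i:=\{\langle x_i:i<\delta\rangle:(\exists\zeta<\kappa)(\forall i<\delta)\ x_i\in X_i(\zeta)\}$. $\mathrm{SDHL}(\delta,\sigma,\kappa)$ (for nonzero ordinals $\delta,\sigma$ and an infinite cardinal $\kappa$) is the statement: given any sequence $\langle T_i\subseteq{}^{<\kappa}\kappa:i<\delta\rangle$ of regular trees and any coloring $c:\bigotimes_{i<\delta}T_i\to\sigma$, there exist $\zeta<\zeta'<\kappa$, $\langle t_i\in T_i(\zeta):i<\delta\rangle$,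 and $\langle X_i\subseteq T_i(\zeta'):i<\delta\rangle$ such that each $X_i$ dominates $T_i(\zeta+1)\cap\mathrm{Cone}(t_i)$ and $|c[\bigotimes_{i<\delta}X_i]|=1$. (For $\delta=1$ this concerns a single regular tree $T$ and a coloring $c:T\to\sigma$.) -}

module Defs where

open import Level using (Level; suc; _⊔_; 0ℓ)
open import Data.Nat.Base using (ℕ)
open import Data.Fin.Base as Fin using (Fin)
open import Data.Fin.Properties as Fin using (<-isStrictTotalOrder)
open import Data.Fin.Induction as Fin using (<-wellFounded)
open import Data.Product.Base using (Σ; Σ-syntax; ∃-syntax; _×_; _,_; proj₁; proj₂)
open import Data.Product using (∃!)
open import Data.Sum.Base using (_⊎_)
open import Function.Bundles using (Func; Injection; Bijection)
open import Induction.WellFounded using (WellFounded)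
open import Relation.Binary.Bundles using (Setoid)
open import Relation.Binary.Core using (Rel)
open import Relation.Binary.Structures using (IsStrictTotalOrder)
open import Relation.Binary.PropositionalEquality using (_≡_; refl; sym; trans; setoid)
open import Relation.Nullary.Negation using (¬_)
open import Relation.Unary using (Pred; _∈_; _⊆_; _∩_)
import Relation.Binary.Construct.On as On

private
  variable
    a b p q u ℓ ℓ₁ ℓ₂ : Level

-- Cardinalities are compared through setoids, so that a subset, given as a
-- predicate, is counted by its elements and not by its membership proofs.

subset : (S : Setoid a ℓ) → Pred (Setoid.Carrier S) p → Setoid (a ⊔ p) ℓ
subset S P = On.setoid {B = Σ (Setoid.Carrier S) P} S proj₁

infix 4 _≼_ _≺_ _≋_

_≼_ : Setoid a ℓ₁ → Setoid b ℓ₂ → Set _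
A ≼ B = Injection A B

_≺_ : Setoid a ℓ₁ → Setoid b ℓ₂ → Set _
A ≺ B = (A ≼ B) × ¬ (B ≼ A)

_≋_ : Setoid a ℓ₁ → Setoid b ℓ₂ → Set _
A ≋ B = Bijection A B

-- An ordinal is represented by a well-ordered type; the elements of the
-- carrier play the role of the smaller ordinals.

record Ordinal (u : Level) : Set (suc u) where
  infix 4 _<_ _≤_
  field
    Carrier            : Set u
    _<_                : Rel Carrier u
    isStrictTotalOrder : IsStrictTotalOrder _≡_ _<_
    wellFounded        : WellFounded _<_

  _≤_ : Rel Carrier u
  α ≤ β = α < β ⊎ α ≡ β

  IsSuccessorOf : Rel Carrier u
  IsSuccessorOf β α = α < β × (∀ γ → α < γ → β ≤ γ)

  asSetoid : Setoid u u
  asSetoid = setoid Carrier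

  below : Carrier → Setoid u u
  below α = subset asSetoid (_< α)

finite : ℕ → Ordinal 0ℓ
finite n = record
  { Carrier            = Fin n
  ; _<_                = Fin._<_
  ; isStrictTotalOrder = Fin.<-isStrictTotalOrder
  ; wellFounded        = Fin.<-wellFounded
  }

-- A cardinal is an initial ordinal, i.e. |α| < |κ| for every α < κ.

record InfiniteCardinal (u : Level) : Set (suc u) where
  field
    ordinal : Ordinal u
  open Ordinal ordinal public
  field
    initial  : ∀ α → below α ≺ asSetoid
    infinite : setoid ℕ ≼ asSetoid

module _ (κ : InfiniteCardinal u) where
  open InfiniteCardinal κ

  -- Elements of ^{<κ}κ.  The proof of ξ < len is irrelevant, so the value at ξ
  -- depends on ξ only.

  record Seq : Set u where
    field
      len : Carrier
      at  : (ξ : Carrier) → .(ξ < len) → Carrier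
  open Seq public

module _ {κ : InfiniteCardinal u} where
  open InfiniteCardinal κ

  infix 4 _≈_ _⊑_

  Agree : Rel (Seq κ) u
  Agree s t = ∀ ξ → (p : ξ < len s) (q : ξ < len t) → at s ξ p ≡ at t ξ q

  _≈_ : Rel (Seq κ) u
  s ≈ t = len s ≡ len t × Agree s t

  _⊑_ : Rel (Seq κ) u
  s ⊑ t = len s ≤ len t × Agree s t

  ≈-refl : ∀ {s} → s ≈ s
  ≈-refl = refl , λ ξ p q → refl

  ≈-sym : ∀ {s t} → s ≈ t → t ≈ s
  ≈-sym (e , f) = sym e , λ ξ p q → sym (f ξ q p)

  ≈-trans : ∀ {s t r} → s ≈ t → t ≈ r → s ≈ r
  ≈-trans (refl , f) (refl , g) = refl , λ ξ p q → trans (f ξ p p) (g ξ p q)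

  seqSetoid : Setoid u u
  seqSetoid = record
    { Carrier       = Seq κ
    ; _≈_           = _≈_
    ; isEquivalence = record { refl = ≈-refl ; sym = ≈-sym ; trans = ≈-trans }
    }

  Cone : Seq κ → Pred (Seq κ) u
  Cone t s = t ⊑ s

  level : Pred (Seq κ) p → Carrier → Pred (Seq κ) (u ⊔ p)
  level X ζ s = s ∈ X × len s ≡ ζ

  Dominates : Pred (Seq κ) p → Pred (Seq κ) q → Set _
  Dominates X Y = ∀ y → y ∈ Y → ∃[ x ] x ∈ X × y ⊑ x

  IsTree : Pred (Seq κ) u → Set u
  IsTree T = ∀ s t → s ⊑ t → t ∈ T → s ∈ T

  IsκTree : Pred (Seq κ) u → Set u
  IsκTree T = subset seqSetoid T ≋ asSetoid
            × (∀ ζ → subset seqSetoid (level T ζ) ≺ asSetoid)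

  ImmediateSuccessorIn : Pred (Seq κ) u → Seq κ → Pred (Seq κ) u
  ImmediateSuccessorIn T t s = s ∈ T × t ⊑ s × IsSuccessorOf (len s) (len t)

  Splits : Pred (Seq κ) u → Seq κ → Set u
  Splits T t = ∃[ s ] ∃[ s′ ] s ∈ ImmediateSuccessorIn T t
                            × s′ ∈ ImmediateSuccessorIn T t
                            × ¬ (s ≈ s′)

  IsPerfect : Pred (Seq κ) u → Set u
  IsPerfect T = ∀ t → t ∈ T → ∃[ s ] s ∈ T × t ⊑ s × Splits T s

  IsChain : Pred (Seq κ) u → Set u
  IsChain B = ∀ s t → s ∈ B → t ∈ B → s ⊑ t ⊎ t ⊑ s

  IsMaximalBranch : Pred (Seq κ) u → Pred (Seq κ) u → Set (suc u)
  IsMaximalBranch T B =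
    B ⊆ T × IsChain B ×
    (∀ (C : Pred (Seq κ) u) → C ⊆ T → IsChain C → B ⊆ C → C ⊆ B)

  CofinalIn : Pred (Seq κ) u → Pred (Seq κ) u → Set u
  CofinalIn B C = C ⊆ B × Dominates C B

  -- κ is the least cardinality of a cofinal subset of (B, ⊑).
  HasCofinalityκ : Pred (Seq κ) u → Set (suc u)
  HasCofinalityκ B =
    (Σ[ C ∈ Pred (Seq κ) u ] CofinalIn B C × subset seqSetoid C ≋ asSetoid) ×
    (∀ (C : Pred (Seq κ) u) → CofinalIn B C → asSetoid ≼ subset seqSetoid C)

  record IsRegular (T : Pred (Seq κ) u) : Set (suc u) where
    field
      isTree           : IsTree T
      isκTree          : IsκTree T
      isPerfect        : IsPerfect T
      branchCofinality : ∀ B → IsMaximalBranch T B → HasCofinalityκ B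

  tupleSetoid : Set a → Setoid (a ⊔ u) (a ⊔ u)
  tupleSetoid I = record
    { Carrier       = I → Seq κ
    ; _≈_           = λ x y → ∀ i → x i ≈ y i
    ; isEquivalence = record
      { refl  = λ i → ≈-refl
      ; sym   = λ e i → ≈-sym (e i)
      ; trans = λ e f i → ≈-trans (e i) (f i)
      }
    }

  ⨂ : {I : Set a} → (I → Pred (Seq κ) p) → Pred (I → Seq κ) (a ⊔ u ⊔ p)
  ⨂ X x = ∃[ ζ ] ∀ i → x i ∈ level (X i) ζ

  Colouring : (I : Set a) → (I → Pred (Seq κ) p) → Ordinal b → Set _
  Colouring I T σ = Func (subset (tupleSetoid I) (⨂ T)) (Ordinal.asSetoid σ)

  -- The image c[P ∩ ⨂ T].
  image : {I : Set a} (T : I → Pred (Seq κ) p) (σ : Ordinal b) →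
          Colouring I T σ → Pred (I → Seq κ) q → Pred (Ordinal.Carrier σ) _
  image T σ c P v = ∃[ x ] proj₁ x ∈ P × Func.to c x ≡ v

SDHL : Ordinal a → Ordinal b → InfiniteCardinal u → Set (a ⊔ b ⊔ suc u)
SDHL {u = u} δ σ κ =
  (T : I → Pred (Seq κ) u) → (∀ i → IsRegular (T i)) →
  (c : Colouring I T σ) →
  ∃[ ζ ] ∃[ ζ+1 ] ∃[ ζ′ ] IsSuccessorOf ζ+1 ζ × ζ < ζ′ ×
  (Σ[ t ∈ (I → Seq κ) ] Σ[ X ∈ (I → Pred (Seq κ) u) ]
    (∀ i → t i ∈ level (T i) ζ) ×
    (∀ i → X i ⊆ level (T i) ζ′) ×
    (∀ i → Dominates (X i) (level (T i) ζ+1 ∩ Cone (t i))) ×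
    ∃! _≡_ (image T σ c (⨂ X)))
  where
  open InfiniteCardinal κ
  I = Ordinal.Carrier δ

{-# OPTIONS --safe #-}

-- Perfectness gives every node of T a successor in T, so fix a node t₀ and let
-- ζ′ be the k-th successor of its length.  If no node t ⊒ t₀ below level ζ′ had a
-- monochromatic dominating set at level ζ′, then every such t would have, for
-- each colour, an immediate successor none of whose extensions at level ζ′ has
-- that colour.  Excluding one colour per step leads from t₀ to a node of level
-- ζ′ that cannot have any colour.

module Submission where

open import Defs
open import Axiom.ExcludedMiddle using (ExcludedMiddle)
open import Data.Nat.Base using (ℕ; NonZero)
import Data.Nat.Base as ℕ
import Data.Nat.Properties as ℕ
open import Data.Fin.Base using (Fin; zero; toℕ)
open import Data.Fin.Properties using (toℕ<n; toℕ-injective)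
open import Data.Product.Base using (Σ-syntax; ∃-syntax; _×_; _,_; proj₁; proj₂)
open import Data.Sum.Base using (inj₁; inj₂)
open import Function.Bundles using (Func; Injection; Bijection)
open import Induction.WellFounded using (Acc; acc)
open import Level using (Level)
open import Relation.Binary.Definitions using (tri<; tri≈; tri>)
open import Relation.Binary.PropositionalEquality using (_≡_; refl; sym; trans; isEquivalence)
open import Relation.Binary.Structures using (IsStrictTotalOrder)
open import Relation.Nullary.Decidable.Core using (yes; no)
open import Relation.Nullary.Negation using (¬_; contradiction)
open import Relation.Unary using (Pred; _∈_; _∩_)
import Relation.Binary.Construct.StrictToNonStrict as NonStrict

private
  variable
    u : Level

module _ (em : ∀ ℓ → ExcludedMiddle ℓ) (κ : InfiniteCardinal u) where
  open InfiniteCardinal κ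
  open IsStrictTotalOrder isStrictTotalOrder using (compare; irrefl; <-resp-≈)
    renaming (trans to <-trans)

  private
    module NS = NonStrict _≡_ _<_

  ≤-trans : ∀ {α β γ} → α ≤ β → β ≤ γ → α ≤ γ
  ≤-trans = NS.trans isEquivalence <-resp-≈ <-trans

  <-≤-trans : ∀ {α β γ} → α < β → β ≤ γ → α < γ
  <-≤-trans = NS.<-≤-trans <-trans (proj₁ <-resp-≈)

  ≤-<-trans : ∀ {α β γ} → α ≤ β → β < γ → α < γ
  ≤-<-trans = NS.≤-<-trans sym <-trans (proj₂ <-resp-≈)

  ≤-antisym : ∀ {α β} → α ≤ β → β ≤ α → α ≡ β
  ≤-antisym = NS.antisym isEquivalence <-trans irrefl

  successor-unique : ∀ {α β γ} → IsSuccessorOf β α → IsSuccessorOf γ α → β ≡ γ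
  successor-unique (α<β , β-least) (α<γ , γ-least) =
    ≤-antisym (β-least _ α<γ) (γ-least _ α<β)

  -- Well-founded descent from `β`: as long as something lies strictly between `α` and the current
  -- bound, it becomes the new bound. A bound with nothing in between is the successor.
  successor-exists : ∀ {α β} → α < β → ∃[ γ ] IsSuccessorOf γ α
  successor-exists {α} α<β = go (wellFounded _) α<β
    where
    go : ∀ {β} → Acc _<_ β → α < β → ∃[ γ ] IsSuccessorOf γ α
    go {β} (acc rs) α<β with em u {∃[ δ ] α < δ × δ < β}
    ... | yes (δ , α<δ , δ<β) = go (rs δ<β) α<δ
    ... | no none = β , α<β , least
      where
      least : ∀ γ → α < γ → β ≤ γ
      least γ α<γ with compare β γ
      ... | tri< β<γ _ _ = inj₁ β<γ
      ... | tri≈ _ β≡γ _ = inj₂ β≡γ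
      ... | tri> _ _ γ<β = contradiction (γ , α<γ , γ<β) none

  -- Successors are peeled off at the bottom, so that passing from a node to an immediate successor
  -- lowers the count by one and keeps the target level fixed.
  data IteratedSuccessor (α : Carrier) : ℕ → Carrier → Set u where
    here : IteratedSuccessor α 0 α
    next : ∀ {n β γ} → IsSuccessorOf β α → IteratedSuccessor β n γ →
           IteratedSuccessor α (ℕ.suc n) γ

  iteratedSuccessor⇒≤ : ∀ {n α β} → IteratedSuccessor α n β → α ≤ β
  iteratedSuccessor⇒≤ here               = inj₂ refl
  iteratedSuccessor⇒≤ (next (α<β , _) r) = inj₁ (<-≤-trans α<β (iteratedSuccessor⇒≤ r))

  ⊑-refl : ∀ {s : Seq κ} → s ⊑ s
  ⊑-refl = inj₂ refl , λ _ _ _ → refl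

  ⊑-trans : ∀ {s t r : Seq κ} → s ⊑ t → t ⊑ r → s ⊑ r
  ⊑-trans (s≤t , s~t) (t≤r , t~r) = ≤-trans s≤t t≤r , λ ξ p q →
    trans (s~t ξ p (<-≤-trans p s≤t)) (t~r ξ (<-≤-trans p s≤t) q)

  restrict : (s : Seq κ) (β : Carrier) → β ≤ len s → Seq κ
  restrict s β β≤ = record { len = β ; at = λ ξ ξ<β → at s ξ (<-≤-trans ξ<β β≤) }

  module _ {T : Pred (Seq κ) u} (isTree : IsTree T) (isPerfect : IsPerfect T) where

    -- The splitting node `s` given by perfectness may lie far above `t`. Its successor `r` is
    -- strictly longer than `t`, and cutting `r` at the successor of `len t` stays in `T` by closure
    -- under initial segments.
    immediateSuccessor : ∀ {t} → t ∈ T → ∃[ s ] s ∈ ImmediateSuccessorIn T t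
    immediateSuccessor {t} t∈T with isPerfect t t∈T
    ... | s , _ , t⊑s , r , _ , (r∈T , s⊑r , s<r , _) , _
      with ≤-<-trans (proj₁ t⊑s) s<r
    ... | t<r with successor-exists t<r
    ... | β , β-succ@(t<β , β-least) =
      r↾β , isTree r↾β r (β≤r , λ _ _ _ → refl) r∈T , (inj₁ t<β , agree) , β-succ
      where
      β≤r : β ≤ len r
      β≤r = β-least _ t<r

      r↾β : Seq κ
      r↾β = restrict r β β≤r

      agree : Agree t r↾β
      agree ξ p q = proj₂ (⊑-trans {t} {s} {r} t⊑s s⊑r) ξ p (<-≤-trans q β≤r)

    iteratedSuccessor-exists : ∀ n {t} → t ∈ T → ∃[ ζ ] IteratedSuccessor (len t) n ζ
    iteratedSuccessor-exists ℕ.zero    t∈T = _ , here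
    iteratedSuccessor-exists (ℕ.suc n) t∈T with immediateSuccessor t∈T
    ... | s , s∈T , _ , s-succ with iteratedSuccessor-exists n s∈T
    ... | ζ , r = ζ , next s-succ r

    module _ (colour : ∀ s → s ∈ T → ℕ) where

      HasColourAt : Carrier → ℕ → Pred (Seq κ) u
      HasColourAt ζ m s = Σ[ s∈ ∈ s ∈ level T ζ ] colour s (proj₁ s∈) ≡ m

      -- The nonemptiness component makes the image exactly one colour.
      Monochromatic : Set u
      Monochromatic = ∃[ ζ ] ∃[ ζ+1 ] ∃[ ζ′ ] IsSuccessorOf ζ+1 ζ × ζ < ζ′ ×
        (∃[ t ] ∃[ m ] t ∈ level T ζ ×
          Dominates (HasColourAt ζ′ m) (level T ζ+1 ∩ Cone t) ×
          ∃[ x ] x ∈ HasColourAt ζ′ m)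

      -- Induction on `m`, which bounds the colours still possible at level `ζ′` above `t` and also
      -- counts the levels from `t` up to `ζ′`; both drop together.
      monochromatic : ∀ m {t ζ′} → t ∈ T → IteratedSuccessor (len t) m ζ′ →
        (∀ x → (x∈ : x ∈ level T ζ′) → t ⊑ x → colour x (proj₁ x∈) ℕ.< m) →
        Monochromatic
      -- With no level left, `t` itself lies at level `ζ′`, and its colour would be below zero.
      monochromatic ℕ.zero {t} t∈T here few =
        contradiction (few t (t∈T , refl) (⊑-refl {t})) ℕ.n≮0
      monochromatic (ℕ.suc m) {t} {ζ′} t∈T (next {β = β} β-succ r) few
        -- The colour tested is the largest one that `few` permits, so avoiding it above `s` lowers
        -- the strict bound to `m`.
        with em u {∃[ s ] s ∈ level T β ∩ Cone t × ¬ (∃[ x ] x ∈ HasColourAt ζ′ m × s ⊑ x)}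
      ... | yes (s , ((s∈T , refl) , t⊑s) , avoids) =
        monochromatic m s∈T r λ x x∈ s⊑x →
          ℕ.≤∧≢⇒< (ℕ.s≤s⁻¹ (few x x∈ (⊑-trans {t} {s} {x} t⊑s s⊑x)))
                  (λ x-colour → avoids (x , (x∈ , x-colour) , s⊑x))
      ... | no none =
        _ , β , ζ′ , β-succ , <-≤-trans (proj₁ β-succ) (iteratedSuccessor⇒≤ r) ,
        t , m , (t∈T , refl) , dominates , nonempty
        where
        dominates : Dominates (HasColourAt ζ′ m) (level T β ∩ Cone t)
        dominates s s∈ with em u {∃[ x ] x ∈ HasColourAt ζ′ m × s ⊑ x}
        ... | yes found = found
        ... | no avoids = contradiction (s , s∈ , avoids) none

        nonempty : ∃[ x ] x ∈ HasColourAt ζ′ m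
        nonempty with immediateSuccessor t∈T
        ... | s , s∈T , t⊑s , s-succ
          with dominates s ((s∈T , successor-unique s-succ β-succ) , t⊑s)
        ... | x , x∈ , _ = x , x∈

fact2p4 : (∀ ℓ → ExcludedMiddle ℓ) →
    ∀ {u} (κ : InfiniteCardinal u) (k : ℕ) .{{_ : NonZero k}} →
    SDHL (finite 1) (finite k) κ
fact2p4 em {u} κ k T regular c =
  let ζ , ζ+1 , ζ′ , ζ+1-succ , ζ<ζ′ , t , m , t∈ , dominates , x , x∈X@((x∈T , _) , _) = mono
  in ζ , ζ+1 , ζ′ , ζ+1-succ , ζ<ζ′ , (λ _ → t) , (λ _ → X ζ′ m) ,
     (λ { zero → t∈ }) , (λ { zero → proj₁ }) , (λ { zero → dominates }) ,
     colour x x∈T ,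
     (constant x x∈T , (len x , λ _ → x∈X , refl) , refl) ,
     λ {_} → one-colour x∈X
  where
  open InfiniteCardinal κ
  open IsRegular (regular zero)

  T₀ : Pred (Seq κ) u
  T₀ = T zero

  constant : ∀ s → s ∈ T₀ → Σ[ x ∈ (Fin 1 → Seq κ) ] x ∈ ⨂ T
  constant s s∈T = (λ _ → s) , len s , λ { zero → s∈T , refl }

  colour : ∀ s → s ∈ T₀ → Fin k
  colour s s∈T = Func.to c (constant s s∈T)

  X : Carrier → ℕ → Pred (Seq κ) u
  X = HasColourAt em κ isTree isPerfect (λ s s∈T → toℕ (colour s s∈T))

  mono : Monochromatic em κ isTree isPerfect (λ s s∈T → toℕ (colour s s∈T))
  mono =
    -- `T₀` is inhabited: it is in bijection with `κ`, which contains the image of 0 under the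
    -- injection of the naturals.
    let (_ , t₀∈T) , _ =
          Bijection.strictlySurjective (proj₁ isκTree) (Injection.to infinite 0)
        -- One level for each of the `k` colours.
        _ , r = iteratedSuccessor-exists em κ isTree isPerfect k t₀∈T
    in monochromatic em κ isTree isPerfect _ k t₀∈T r
         λ x x∈ _ → toℕ<n (colour x (proj₁ x∈))

  -- The tuple `y` and its membership proof need not be definitionally those of `constant`, but `c`
  -- respects pointwise equality of tuples, so `y` has the colour of its only entry.
  one-colour : ∀ {ζ′ m x} (x∈X : x ∈ X ζ′ m) {v} →
               image T (finite k) c (⨂ (λ _ → X ζ′ m)) v →
               colour x (proj₁ (proj₁ x∈X)) ≡ v
  one-colour (_ , x-colour) ((y , y∈⨂T) , (_ , y∈X) , refl) with y∈X zero
  ... | (_ , y-colour) , _ =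
    trans (toℕ-injective (trans x-colour (sym y-colour)))
          (Func.cong c λ { zero → ≈-refl {s = y zero} })
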